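{- Let $n\ge 1$, write $n=3q+r$ with $q,r$ integers, $0\le r<3$, let $s$ be the word $12\dots n$, and let $W^n$ be a word of minimal length among the words over $[n]$ fixing all $n$-component monotone networks. Then the word \[ \tilde W^n:=q\cdot(s\,s\,W^n),\ r\cdot s \] fixes every $n$-component balanced network. Therefore \[ \lambda_M(n)\ \le\ \lambda_B(n)\ \le\ \frac n3\,\lambda_M(n)+n^2 . \]
   Context: An $n$-component (Boolean) network is a function $f=(f_1,\dots,f_n):\{0,1\}^n\to\{0,1\}^n$. Write $[n]=\{1,\dots,n\}$. For $i\in[n]$, $f^i(x):=(x_1,\dots,x_{i-1},f_i(x),x_{i+1},\dots,x_n)$, and for a word $w=i_1\dots i_k$ over $[n]$, $f^w:=f^{i_k}\circ\cdots\circ f^{i_1}$ (identity for the empty word). A word $w$ fixes $f$ if $f^w(x)$ is a fixed point of $f$ for every $x$. For a word $u$ and integer $k\ge0$, $k\cdot u$ denotes $u$ repeated $k$ times (empty word if $k=0$); juxtaposition and commas denote concatenation. $f$ is monotone if $x\le y$ (componentwise) implies $f(x)\le f(y)$. The interaction graph of $f$ is the directed graph on $[n]$ (loops allowed) with an edge from $j$ to $i$ iff there exist $x,y$ differing only in component $j$ with $f_i(x)\ne f_i(y)$. In the signed interaction graph, each such edge $ji$ gets the sign $\sigma(ji)=1$ if $f_i(x)\le f_i(x+e_j)$ for all $x$ with $x_j=0$; $\sigma(ji)=-1$ if $f_i(x)\ge f_i(x+e_j)$ for all $x$ with $x_j=0$; and $\sigma(ji)=0$ otherwise (here $e_j$ is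 the $j$-th unit vector and addition is modulo two). The sign of a (directed, without repeated vertices) cycle is the product of the signs of its edges. $f$ is balanced if all cycles of its signed interaction graph have sign $1$. $\lambda_M(n)$ (resp. $\lambda_B(n)$) is the minimum length of a single word over $[n]$ fixing all $n$-component monotone (resp. balanced) networks. (It is known that some word fixes all $n$-component monotone networks.) -}

module Defs where

open import Data.Bool.Base using (Bool; false; not; if_then_else_; _≤_)
open import Data.Bool.Properties using (_≟_; _≤?_)
open import Data.Fin.Base using (Fin)
open import Data.Fin.Subset.Properties using (anySubset?)
open import Data.Integer.Base as ℤ using (ℤ; 0ℤ; 1ℤ; -1ℤ)
open import Data.List.Base
  using (List; _++_; _∷ʳ_; allFin; concat; foldl; foldr; length; map; replicate; zip)
open import Data.List.NonEmpty.Base using (List⁺; _∷_; toList)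
open import Data.List.Relation.Unary.All using (All)
open import Data.List.Relation.Unary.Unique.Propositional using (Unique)
open import Data.Nat.Base as ℕ using (ℕ)
open import Data.Product.Base using (_×_; _,_; ∃-syntax; uncurry)
open import Data.Vec.Base using (Vec; lookup; _[_]≔_; _[_]%=_)
open import Data.Vec.Relation.Binary.Pointwise.Inductive using (Pointwise)
open import Function.Base using (_∘_)
open import Relation.Binary.Definitions using (Monotonic₁)
open import Relation.Binary.PropositionalEquality using (_≡_; _≢_)
open import Relation.Nullary.Decidable
  using (Dec; does; map′; ¬?; _→-dec_; decidable-stable)
open import Relation.Unary using (Decidable)

State : ℕ → Set
State n = Vec Bool n

-- Component i ∈ {1,…,n} is the element of Fin n with value i − 1.
Network : ℕ → Set
Network n = State n → State n

Word : ℕ → Set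
Word n = List (Fin n)

private
  variable
    n : ℕ

update : Network n → Fin n → State n → State n
update f i x = x [ i ]≔ lookup (f x) i

-- The first letter of the word is applied first.
run : Network n → Word n → State n → State n
run f w x = foldl (λ y i → update f i y) x w

Fixes : Word n → Network n → Set
Fixes w f = ∀ x → f (run f w x) ≡ run f w x

FixesAll : (Network n → Set) → Word n → Set
FixesAll P w = ∀ f → P f → Fixes w f

IsShortestFixing : (Network n → Set) → Word n → Set
IsShortestFixing P w =
  FixesAll P w × (∀ w′ → FixesAll P w′ → length w ℕ.≤ length w′)

IsMinFixingLength : (Network n → Set) → ℕ → Set
IsMinFixingLength P ℓ = ∃[ w ] (IsShortestFixing P w × length w ≡ ℓ)

_≼_ : State n → State n → Set
_≼_ = Pointwise _≤_

Monotone : Network n → Set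
Monotone f = Monotonic₁ _≼_ _≼_ f

DifferOnlyAt : Fin n → State n → State n → Set
DifferOnlyAt j x y =
  lookup x j ≢ lookup y j × (∀ k → k ≢ j → lookup x k ≡ lookup y k)

-- Edge f j i : there is an edge from j to i.
Edge : Network n → Fin n → Fin n → Set
Edge f j i = ∃[ x ] ∃[ y ] (DifferOnlyAt j x y × lookup (f x) i ≢ lookup (f y) i)

Nondecreasing : Network n → Fin n → Fin n → Set
Nondecreasing f j i =
  ∀ x → lookup x j ≡ false → lookup (f x) i ≤ lookup (f (x [ j ]%= not)) i

Nonincreasing : Network n → Fin n → Fin n → Set
Nonincreasing f j i =
  ∀ x → lookup x j ≡ false → lookup (f (x [ j ]%= not)) i ≤ lookup (f x) i

-- Subset n is by definition Vec Bool n.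
allState? : {P : State n → Set} → Decidable P → Dec (∀ x → P x)
allState? P? = map′
  (λ ¬∃¬ x → decidable-stable (P? x) (λ ¬Px → ¬∃¬ (x , ¬Px)))
  (λ { ∀P (x , ¬Px) → ¬Px (∀P x) })
  (¬? (anySubset? (¬? ∘ P?)))

nondecreasing? : (f : Network n) (j i : Fin n) → Dec (Nondecreasing f j i)
nondecreasing? f j i = allState? λ x →
  (lookup x j ≟ false) →-dec (lookup (f x) i ≤? lookup (f (x [ j ]%= not)) i)

nonincreasing? : (f : Network n) (j i : Fin n) → Dec (Nonincreasing f j i)
nonincreasing? f j i = allState? λ x →
  (lookup x j ≟ false) →-dec (lookup (f (x [ j ]%= not)) i ≤? lookup (f x) i)

-- Meaningful only on edges, where the first two conditions exclude each other.
σ : Network n → Fin n → Fin n → ℤ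
σ f j i =
  if does (nondecreasing? f j i) then 1ℤ else
  if does (nonincreasing? f j i) then -1ℤ else 0ℤ

-- (v₁,v₂), (v₂,v₃), …, (vₖ,v₁); a single vertex gives the loop (v₁,v₁).
arcs : List⁺ (Fin n) → List (Fin n × Fin n)
arcs (v ∷ vs) = zip (toList (v ∷ vs)) (vs ∷ʳ v)

IsCycle : Network n → List⁺ (Fin n) → Set
IsCycle f c = Unique (toList c) × All (uncurry (Edge f)) (arcs c)

cycleSign : Network n → List⁺ (Fin n) → ℤ
cycleSign f c = foldr ℤ._*_ 1ℤ (map (uncurry (σ f)) (arcs c))

Balanced : Network n → Set
Balanced f = ∀ c → IsCycle f c → cycleSign f c ≡ 1ℤ

infixr 7 _·_

_·_ : ℕ → Word n → Word n
k · u = concat (replicate k u)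

W̃ : ℕ → ℕ → Word n → Word n
W̃ {n} q r W = q · (s ++ s ++ W) ++ r · s
  where
  s : Word n
  s = allFin n

{-# OPTIONS --safe #-}

-- In a balanced network every closed walk has sign 1, because cutting cycles
-- out of a walk does not change its sign. Hence on a strong component the signs
-- of walks from a root define a switching that turns f into a monotone network.
-- Once the predecessors of a component C have reached their final values, f on
-- C is therefore simulated by a monotone network that is idle outside C: W fixes
-- C whatever its size, ss fixes C if |C| ≤ 2, and s fixes C if |C| = 1. Taking
-- the components in topological order, each block ssW settles at least three
-- new vertices, and the remaining r ≤ 2 vertices are settled by r·s.
--
-- Reachability is used only to show that a state is fixed, which is a stable
-- proposition, so it can be assumed decidable. The existence of a shortest word
-- fixing all balanced networks comes from an exhaustive search.
module Submission where

open import Defs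
open import Data.Bool.Base using (Bool; true; false; not; _xor_; if_then_else_; b≤b; f≤t)
  renaming (_≤_ to _≤ᵇ_)
import Data.Bool.Properties as Bool
open import Data.Fin.Base using (Fin; zero; suc)
open import Data.Fin.Induction using (spo-wellFounded; Acc; acc)
open import Data.Fin.Properties using (_≟_; any?; all?; sequence)
open import Data.Fin.Subset using (Subset; _∈_; _∉_; _⊆_; _∪_; ∣_∣; ⊤; ⁅_⁆) renaming (⊥ to ∅)
open import Data.Fin.Subset.Properties
  using (_∈?_; x∈p∪q⁻; x∈p∪q⁺; p⊆p∪q; p⊂q⇒∣p∣<∣q∣; p⊆q⇒∣p∣≤∣q∣; ∣p∣≤n; ∣⊤∣≡n; ∣⊥∣≡0;
         ∣p∣≡n⇒p≡⊤; ∈⊤; ∉⊥; x∈⁅x⁆; x∈⁅y⁆⇒x≡y; anySubset?)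
open import Data.Integer.Base as ℤ using (ℤ; +_; -[1+_]; 0ℤ; 1ℤ; -1ℤ)
import Data.Integer.Properties as ℤ
import Data.Integer.Tactic.RingSolver as ℤ-Solver
open import Data.List.Base using (List; []; _∷_; _++_; _∷ʳ_; allFin; foldr; length; map; zip)
open import Data.List.Membership.DecPropositional using () renaming (_∈?_ to list-∈?)
import Data.List.Membership.Propositional as List
open import Data.List.Membership.Propositional.Properties
  using (∈-allFin; ∈-∃++; ∈-++⁺ˡ; ∈-++⁺ʳ; ∈-++⁻)
open import Data.List.NonEmpty.Base using (List⁺; _∷_; toList)
open import Data.List.Properties using (foldl-++; length-++; length-tabulate; map-cong)
import Data.List.Relation.Binary.Subset.Propositional as List
open import Data.List.Relation.Binary.Subset.Propositional.Properties using (∷⁺ʳ)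
open import Data.List.Relation.Unary.All as All using (All; []; _∷_)
open import Data.List.Relation.Unary.All.Properties using (anti-mono; ¬Any⇒All¬)
open import Data.List.Relation.Unary.AllPairs using ([]; _∷_; allPairs?)
open import Data.List.Relation.Unary.Any using (here; there)
open import Data.List.Relation.Unary.Unique.Propositional using (Unique)
open import Data.Nat.Base as ℕ using (ℕ; zero; suc; _+_; _*_; _≤_; _<_; _^_; s≤s; z≤n)
open import Data.Nat.Induction using (<-rec)
import Data.Nat.Properties as ℕ
import Data.Nat.Tactic.RingSolver as ℕ-Solver
open import Data.Product.Base using (_×_; _,_; ∃-syntax; proj₁; proj₂; uncurry)
open import Data.Rational.Base as ℚ using (_/_)
import Data.Rational.Properties as ℚ
open import Data.Rational.Unnormalised.Base as ℚᵘ using (mkℚᵘ; *≤*)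
import Data.Rational.Unnormalised.Properties as ℚᵘ
open import Data.Sum.Base using (inj₁; inj₂; [_,_]′)
open import Data.Vec.Base using (Vec; []; _∷_; lookup; tabulate; _[_]≔_; _[_]%=_)
open import Data.Vec.Properties
  using (lookup∘update; lookup∘update′; lookup∘updateAt′; lookup∘tabulate; tabulate∘lookup;
         tabulate-cong; []≔-lookup; updateAt-updateAt; []=⇒lookup; lookup⇒[]=; ≡-dec)
open import Data.Vec.Relation.Binary.Pointwise.Extensional using (ext; extensional⇒inductive)
import Data.Vec.Relation.Binary.Pointwise.Inductive as Pointwise
open import Effect.Monad using (RawMonad)
open import Function.Base using (_∘_; const)
open import Function.Bundles using (mk⇔)
open import Level using (0ℓ)
open import Relation.Binary.Construct.Closure.ReflexiveTransitive using (Star; ε; _◅_; _◅◅_)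
open import Relation.Binary.Core using (Rel)
open import Relation.Binary.Definitions using (Reflexive; Transitive)
open import Relation.Binary.PropositionalEquality
open import Relation.Binary.Structures using (IsStrictPartialOrder)
open import Relation.Nullary using (¬_; Dec; does; yes; no; contradiction; ¬?)
open import Relation.Nullary.Decidable
  using (_×-dec_; _→-dec_; map′; dec-true; dec-false; does-⇔; decidable-stable; ¬¬-excluded-middle)
open import Relation.Nullary.Negation using (¬¬-Monad)
open import Relation.Unary using (Decidable)

private
  variable
    m n : ℕ

lookup-ext : {A : Set} {x y : Vec A n} → (∀ i → lookup x i ≡ lookup y i) → x ≡ y
lookup-ext {x = x} {y} eq =
  trans (sym (tabulate∘lookup x)) (trans (tabulate-cong eq) (tabulate∘lookup y))

-- Monotone networks with at most two active vertices

Stable : Network n → Fin n → State n → Set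
Stable f i x = lookup (f x) i ≡ lookup x i

stable⇒fixed : (f : Network n) {x : State n} → (∀ i → Stable f i x) → f x ≡ x
stable⇒fixed f = lookup-ext

update-stable : (f : Network n) {i : Fin n} {x : State n} → Stable f i x → update f i x ≡ x
update-stable f {i} {x} s = trans (cong (x [ i ]≔_) s) ([]≔-lookup x i)

run-++ : (f : Network n) (u v : Word n) (x : State n) → run f (u ++ v) x ≡ run f v (run f u x)
run-++ f u v x = foldl-++ (λ y i → update f i y) x u v

run-fixed : (f : Network n) (w : Word n) {x : State n} → f x ≡ x → run f w x ≡ x
run-fixed f [] fx = refl
run-fixed f (i ∷ w) {x} fx
  rewrite update-stable f {i} {x} (cong (λ y → lookup y i) fx) = run-fixed f w fx

-- Letters before the first occurrence of `i` hit stable vertices and change nothing; `t` is what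
-- follows that occurrence.
run-first : (g : Network n) {x : State n} {i : Fin n} (w : Word n) → i List.∈ w →
  (∀ j → j ≢ i → Stable g j x) → ∃[ t ] run g w x ≡ run g t (update g i x)
run-first g (i ∷ w) (here refl) st = w , refl
run-first g {x} {i} (j ∷ w) (there i∈w) st with j ≟ i
... | yes refl = w , refl
... | no  j≢i rewrite update-stable g {j} {x} (st j j≢i) = run-first g w i∈w st

fixed-after-run : (g : Network n) {x : State n} {i : Fin n} (w : Word n) → i List.∈ w →
  (∀ j → j ≢ i → Stable g j x) → g (update g i x) ≡ update g i x → g (run g w x) ≡ run g w x
fixed-after-run g {x} {i} w i∈w st fx
  with t , eq ← run-first g {x} w i∈w st
  rewrite eq | run-fixed g t {update g i x} fx = fx

-- The relation _ ≡ c → _ ≡ c is the order on Bool in which c is the top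
-- element, so this covers the order and its opposite at once.
monotone-at : {g : Network n} → Monotone g → ∀ c {x y : State n} →
  (∀ k → lookup x k ≡ c → lookup y k ≡ c) → ∀ i → lookup (g x) i ≡ c → lookup (g y) i ≡ c
monotone-at {g = g} mono true {x} {y} x⊑y i eq = up (Pointwise.lookup (mono x≼y) i) eq
  where
  le : ∀ a b → (a ≡ true → b ≡ true) → a ≤ᵇ b
  le false b _ = Bool.≤-minimum b
  le true  b h rewrite h refl = b≤b
  up : ∀ {a b} → a ≤ᵇ b → a ≡ true → b ≡ true
  up b≤b e = e
  x≼y : x ≼ y
  x≼y = extensional⇒inductive (ext λ k → le _ _ (x⊑y k))
monotone-at {g = g} mono false {x} {y} x⊑y i eq = down (Pointwise.lookup (mono y≼x) i) eq
  where
  le : ∀ a b → (a ≡ false → b ≡ false) → b ≤ᵇ a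
  le true  b _ = Bool.≤-maximum b
  le false b h rewrite h refl = b≤b
  down : ∀ {a b} → b ≤ᵇ a → a ≡ false → b ≡ false
  down b≤b e = e
  y≼x : y ≼ x
  y≼x = extensional⇒inductive (ext λ k → le _ _ (x⊑y k))

-- In the order with top `c`, the new value, the update moves `x` up, so `g` still gives `c` at `i`.
update-stabilises : {g : Network n} → Monotone g → ∀ i x → Stable g i (update g i x)
update-stabilises {g = g} mono i x =
  trans (monotone-at mono c {x} {x [ i ]≔ c} raise i refl) (sym (lookup∘update i x c))
  where
  c = lookup (g x) i
  raise : ∀ k → lookup x k ≡ c → lookup (x [ i ]≔ c) k ≡ c
  raise k eq with k ≟ i
  ... | yes refl = lookup∘update i x c
  ... | no  k≢i  = trans (lookup∘update′ k≢i x c) eq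

-- In the order with top `c`, updating `b` moves `x` up. As `a` was stable at `x`, its own update
-- cannot then destroy a value `c`, so the final state `u` is still above `x` and `g` still gives
-- `c` at `b`.
update-update-stable : {g : Network n} → Monotone g → ∀ a b x → Stable g a x →
  Stable g b (update g a (update g b x))
update-update-stable {g = g} mono a b x sa with b ≟ a
... | yes refl = update-stabilises mono b (update g b x)
... | no  b≢a  = trans (monotone-at mono c {x} {u} x⊑u b refl) (sym u-b)
  where
  c = lookup (g x) b
  y = x [ b ]≔ c
  d = lookup (g y) a
  u = y [ a ]≔ d
  u-b : lookup u b ≡ c
  u-b = trans (lookup∘update′ b≢a y d) (lookup∘update b x c)
  x⊑y : ∀ k → lookup x k ≡ c → lookup y k ≡ c
  x⊑y k eq with k ≟ b
  ... | yes refl = lookup∘update b x c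
  ... | no  k≢b  = trans (lookup∘update′ k≢b x c) eq
  x⊑u : ∀ k → lookup x k ≡ c → lookup u k ≡ c
  x⊑u k eq with k ≟ a
  ... | yes refl = trans (lookup∘update a y d)
                     (monotone-at mono c {x} {y} x⊑y a (trans sa eq))
  ... | no  k≢a  = trans (lookup∘update′ k≢a y d) (x⊑y k eq)

word-fixes-single : {g : Network n} → Monotone g → ∀ v →
  (∀ i → i ≢ v → ∀ x → Stable g i x) → ∀ w → v List.∈ w → Fixes w g
word-fixes-single {g = g} mono v st w v∈w x =
  fixed-after-run g w v∈w (λ j j≢v → st j j≢v x) (stable⇒fixed g stable)
  where
  stable : ∀ i → Stable g i (update g v x)
  stable i with i ≟ v
  ... | yes refl = update-stabilises mono v x
  ... | no  i≢v  = st i i≢v _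

-- Once `a` has been updated, only `b` can be unstable, and updating `b` and then `a` reaches a
-- fixed point by `update-update-stable`. The word `w ++ w` offers `a`, then `b`, then `a` in this
-- order.
square-fixes-pair : {g : Network n} → Monotone g → ∀ a b →
  (∀ i → i ≢ a → i ≢ b → ∀ x → Stable g i x) → ∀ w → a List.∈ w → b List.∈ w → Fixes (w ++ w) g
square-fixes-pair {g = g} mono a b st w a∈w b∈w x
  with s₁ , s₂ , refl ← ∈-∃++ a∈w = goal
  where
  w′ = s₁ ++ a ∷ s₂
  y = update g a (run g s₁ x)
  ya : Stable g a y
  ya = update-stabilises mono a (run g s₁ x)
  u = update g a (update g b y)
  gu≡u : g u ≡ u
  gu≡u = stable⇒fixed g stable
    where
    stable : ∀ i → Stable g i u
    stable i with i ≟ a | i ≟ b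
    ... | yes refl | _        = update-stabilises mono a _
    ... | no  _    | yes refl = update-update-stable mono a b y ya
    ... | no  i≢a  | no  i≢b  = st i i≢a i≢b u
  Done : State _ → Set
  Done z = g z ≡ z
  tail : Done (run g (s₂ ++ w′) y)
  tail with b ≟ a
  ... | yes refl = subst Done (sym (run-fixed g (s₂ ++ w′) gy≡y)) gy≡y
    where
    gy≡y : g y ≡ y
    gy≡y = stable⇒fixed g stable
      where
      stable : ∀ i → Stable g i y
      stable i with i ≟ a
      ... | yes refl = ya
      ... | no  i≢a  = st i i≢a i≢a y
  ... | no b≢a = subst Done (sym eq) (step₂ (a∈t++ (proj₁ r)))
    where
    -- `s₂ ++ s₁` lies between the chosen occurrences of `a` in the two copies of `w`, so it
    -- contains every letter of `w` other than `a`.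
    b∈ : b List.∈ s₂ ++ s₁
    b∈ with ∈-++⁻ s₁ b∈w
    ... | inj₁ p         = ∈-++⁺ʳ s₂ p
    ... | inj₂ (here e)  = contradiction e b≢a
    ... | inj₂ (there p) = ∈-++⁺ˡ p
    y-others : ∀ j → j ≢ b → Stable g j y
    y-others j j≢b with j ≟ a
    ... | yes refl = ya
    ... | no  j≢a  = st j j≢a j≢b y
    r = run-first g {y} {b} (s₂ ++ s₁) b∈ y-others
    eq : run g (s₂ ++ w′) y ≡ run g (proj₁ r ++ a ∷ s₂) (update g b y)
    eq = begin
      run g (s₂ ++ s₁ ++ a ∷ s₂) y                   ≡⟨ run-++ g s₂ _ y ⟩
      run g (s₁ ++ a ∷ s₂) (run g s₂ y)              ≡⟨ run-++ g s₁ _ _ ⟩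
      run g (a ∷ s₂) (run g s₁ (run g s₂ y))         ≡⟨ cong (run g (a ∷ s₂)) (run-++ g s₂ s₁ y) ⟨
      run g (a ∷ s₂) (run g (s₂ ++ s₁) y)            ≡⟨ cong (run g (a ∷ s₂)) (proj₂ r) ⟩
      run g (a ∷ s₂) (run g (proj₁ r) (update g b y)) ≡⟨ run-++ g (proj₁ r) _ _ ⟨
      run g (proj₁ r ++ a ∷ s₂) (update g b y)       ∎
      where open ≡-Reasoning
    a∈t++ : ∀ t → a List.∈ t ++ a ∷ s₂
    a∈t++ t = ∈-++⁺ʳ t (here refl)
    others : ∀ j → j ≢ a → Stable g j (update g b y)
    others j j≢a with j ≟ b
    ... | yes refl = update-stabilises mono b y
    ... | no  j≢b  = st j j≢a j≢b _
    step₂ : ∀ {t} → a List.∈ t → Done (run g t (update g b y))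
    step₂ {t} a∈t = fixed-after-run g t a∈t others gu≡u
  goal : Done (run g (w′ ++ w′) x)
  goal = subst Done (sym eq) tail
    where
    eq : run g (w′ ++ w′) x ≡ run g (s₂ ++ w′) y
    eq = trans (run-++ g w′ w′ x) (trans (cong (run g w′) (run-++ g s₁ (a ∷ s₂) x))
           (sym (run-++ g s₂ w′ y)))

-- Signs of closed walks

Walk : Network n → Fin n → Fin n → Set
Walk f = Star (Edge f)

module _ (f : Network n) where

  sign : ∀ {u v} → Walk f u v → ℤ
  sign ε                 = 1ℤ
  sign (_◅_ {u} {w} e p) = σ f u w ℤ.* sign p

  sources : ∀ {u v} → Walk f u v → List (Fin n)
  sources ε             = []
  sources (_◅_ {u} e p) = u ∷ sources p

  sign-◅◅ : ∀ {u v w} (p : Walk f u v) (q : Walk f v w) → sign (p ◅◅ q) ≡ sign p ℤ.* sign q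
  sign-◅◅ ε q = sym (ℤ.*-identityˡ (sign q))
  sign-◅◅ (_◅_ {u} {w} e p) q =
    trans (cong (σ f u w ℤ.*_) (sign-◅◅ p q)) (sym (ℤ.*-assoc (σ f u w) (sign p) (sign q)))

  -- The endpoint `v` is free so that the induction can pass to the tail of a walk. When `v` is `u`,
  -- the list `as` is `arcs (u ∷ sources p)`.
  walk-arcs : ∀ {u w v} (e : Edge f u w) (p : Walk f w v) →
    let as = zip (sources (e ◅ p)) (sources p ∷ʳ v) in
    All (uncurry (Edge f)) as × foldr ℤ._*_ 1ℤ (map (uncurry (σ f)) as) ≡ sign (e ◅ p)
  walk-arcs e ε = e ∷ [] , refl
  walk-arcs {u} e (_◅_ {w} e′ p) with es , eq ← walk-arcs e′ p =
    e ∷ es , cong (σ f u w ℤ.*_) eq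

  -- `before-simple` includes `w` so that an edge from `w` to `u` followed by `before` is a simple
  -- closed walk.
  record SplitAt {u v} (w : Fin n) (p : Walk f u v) : Set where
    field
      before : Walk f u w
      after  : Walk f w v
      sign-split : sign p ≡ sign before ℤ.* sign after
      before-simple : Unique (w ∷ sources before)
      after-simple  : Unique (sources after)
      before⊆ : sources before List.⊆ sources p

  split : ∀ {u v w} (p : Walk f u v) → Unique (sources p) → w List.∈ sources p → SplitAt w p
  split p@(e ◅ _) uniq (here refl) = record
    { before = ε ; after = p ; sign-split = sym (ℤ.*-identityˡ (sign p))
    ; before-simple = [] ∷ [] ; after-simple = uniq ; before⊆ = λ () }
  split {u} {w = w} (_◅_ {j = t} e p) (u∉p ∷ uniq) (there w∈p) = record
    { before = e ◅ before ; after = after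
    ; sign-split = trans (cong (σ f u t ℤ.*_) sign-split)
        (sym (ℤ.*-assoc (σ f u t) (sign before) (sign after)))
    ; before-simple = simple before-simple
    ; after-simple = after-simple ; before⊆ = ∷⁺ʳ u before⊆ }
    where
    open SplitAt (split p uniq w∈p)
    simple : Unique (w ∷ sources before) → Unique (w ∷ u ∷ sources before)
    simple (w∉ ∷ s) = ((λ { refl → All.lookup u∉p w∈p refl }) ∷ w∉) ∷ anti-mono before⊆ u∉p ∷ s

  module _ (bal : Balanced f) where

    simple-closed-walk-sign : ∀ {u w} (e : Edge f u w) (p : Walk f w u) →
      Unique (sources (e ◅ p)) → sign (e ◅ p) ≡ 1ℤ
    simple-closed-walk-sign {u} e p uniq with es , eq ← walk-arcs e p =
      trans (sym eq) (bal (u ∷ sources p) (uniq , es))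

    -- If `u` reappears in the erased tail, the part up to that reappearance closes up to a cycle;
    -- it has sign 1 and is cut out.
    loop-erasure : ∀ {u v} (p : Walk f u v) →
      ∃[ q ] (Unique (sources {u} {v} q) × sign p ≡ sign q)
    loop-erasure ε = ε , [] , refl
    loop-erasure {u} (_◅_ {j = t} e p) with q , uniq , eq ← loop-erasure p
      with list-∈? _≟_ u (sources q)
    ... | no u∉q = e ◅ q , ¬Any⇒All¬ _ u∉q ∷ uniq , cong (σ f u t ℤ.*_) eq
    ... | yes u∈q = after , after-simple , (begin
      σ f u t ℤ.* sign p                          ≡⟨ cong (σ f u t ℤ.*_) (trans eq sign-split) ⟩
      σ f u t ℤ.* (sign before ℤ.* sign after)    ≡⟨ ℤ.*-assoc (σ f u t) (sign before) (sign after) ⟨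
      sign (e ◅ before) ℤ.* sign after
        ≡⟨ cong (ℤ._* sign after) (simple-closed-walk-sign e before before-simple) ⟩
      1ℤ ℤ.* sign after                           ≡⟨ ℤ.*-identityˡ (sign after) ⟩
      sign after                                  ∎)
      where
      open SplitAt (split q uniq u∈q)
      open ≡-Reasoning

    closed-walk-sign : ∀ {v} (p : Walk f v v) → sign p ≡ 1ℤ
    closed-walk-sign p with loop-erasure p
    ... | ε     , _    , eq = eq
    ... | e ◅ q , uniq , eq = trans eq (simple-closed-walk-sign e q uniq)

  σ≡1⇒nondecreasing : ∀ {j i} → σ f j i ≡ 1ℤ → Nondecreasing f j i
  σ≡1⇒nondecreasing {j} {i} = from (nondecreasing? f j i) (nonincreasing? f j i)
    where
    from : {A B : Set} (A? : Dec A) (B? : Dec B) →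
      (if does A? then 1ℤ else if does B? then -1ℤ else 0ℤ) ≡ 1ℤ → A
    from (yes a) _ _ = a
    from (no _) (yes _) ()
    from (no _) (no _) ()

  σ≡-1⇒nonincreasing : ∀ {j i} → σ f j i ≡ -1ℤ → Nonincreasing f j i
  σ≡-1⇒nonincreasing {j} {i} = from (nondecreasing? f j i) (nonincreasing? f j i)
    where
    from : {A B : Set} (A? : Dec A) (B? : Dec B) →
      (if does A? then 1ℤ else if does B? then -1ℤ else 0ℤ) ≡ -1ℤ → B
    from (yes _) _ ()
    from (no _) (yes b) _ = b
    from (no _) (no _) ()

-- Switching a strong component

sgn : Bool → ℤ
sgn false = 1ℤ
sgn true  = -1ℤ

sgn-square : ∀ b → sgn b ℤ.* sgn b ≡ 1ℤ
sgn-square false = refl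
sgn-square true  = refl

unit⇒sgn : ∀ p q → p ℤ.* q ≡ 1ℤ → ∃[ b ] p ≡ sgn b
unit⇒sgn p q pq≡1 = abs≡1 p (ℕ.m*n≡1⇒m≡1 ℤ.∣ p ∣ ℤ.∣ q ∣
  (trans (sym (ℤ.abs-* p q)) (cong ℤ.∣_∣ pq≡1)))
  where
  abs≡1 : ∀ p → ℤ.∣ p ∣ ≡ 1 → ∃[ b ] p ≡ sgn b
  abs≡1 (+ _)    refl = false , refl
  abs≡1 -[1+ _ ] refl = true  , refl

Strong : Network n → Fin n → Fin n → Set
Strong f v i = Walk f v i × Walk f i v

-- z switches f, on the strong component of v, to a network with only positive edges.
Potential : Network n → Fin n → (Fin n → Bool) → Set
Potential f v z = ∀ {j i} → Strong f v j → Strong f v i → Edge f j i →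
  σ f j i ≡ sgn (z j) ℤ.* sgn (z i)

-- `z i` records the sign of a walk from `v` to `i`. All such walks have the same sign, since each
-- closes up to sign 1 with the same return walk. Appending the edge from `j` to `i` to a walk
-- ending at `j` then yields the equation.
potential : (f : Network n) → Balanced f → (∀ u v → Dec (Walk f u v)) →
  ∀ v → ∃[ z ] Potential f v z
potential {n} f bal walk? v = z , switches
  where
  walk-sign : ∀ i → ∃[ b ] (Walk f i v → (p : Walk f v i) → sign f p ≡ sgn b)
  walk-sign i with walk? i v | walk? v i
  -- Outside the strong component of `v` the value is arbitrary: the condition on it is vacuous.
  ... | no ¬q | _     = false , λ q → contradiction q ¬q
  ... | yes _ | no ¬p = false , λ _ p → contradiction p ¬p
  ... | yes q | yes p₀ = b , λ _ p → begin
      sign f p                                        ≡⟨ ℤ.*-identityʳ (sign f p) ⟨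
      sign f p ℤ.* 1ℤ                                 ≡⟨ cong (sign f p ℤ.*_) (closed p₀) ⟨
      sign f p ℤ.* (sign f p₀ ℤ.* sign f q)           ≡⟨ rearrange (sign f p) (sign f p₀) (sign f q) ⟩
      sign f p₀ ℤ.* (sign f p ℤ.* sign f q)           ≡⟨ cong (sign f p₀ ℤ.*_) (closed p) ⟩
      sign f p₀ ℤ.* 1ℤ                                ≡⟨ ℤ.*-identityʳ (sign f p₀) ⟩
      sign f p₀                                       ≡⟨ p₀≡ ⟩
      sgn b                                           ∎
    where
    open ≡-Reasoning
    closed : (p : Walk f v i) → sign f p ℤ.* sign f q ≡ 1ℤ
    closed p = trans (sym (sign-◅◅ f p q)) (closed-walk-sign f bal (p ◅◅ q))
    bb = unit⇒sgn (sign f p₀) (sign f q) (closed p₀)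
    b = proj₁ bb
    p₀≡ = proj₂ bb
    rearrange : ∀ x y z → x ℤ.* (y ℤ.* z) ≡ y ℤ.* (x ℤ.* z)
    rearrange = ℤ-Solver.solve-∀
  z : Fin n → Bool
  z i = proj₁ (walk-sign i)
  switches : Potential f v z
  switches {j} {i} (p , q) (_ , q′) e = begin
    s                              ≡⟨ ℤ.*-identityˡ s ⟨
    1ℤ ℤ.* s                       ≡⟨ cong (ℤ._* s) (sgn-square (z j)) ⟨
    (zj ℤ.* zj) ℤ.* s              ≡⟨ ℤ.*-assoc zj zj s ⟩
    zj ℤ.* (zj ℤ.* s)              ≡⟨ cong (λ t → zj ℤ.* (t ℤ.* s)) (proj₂ (walk-sign j) q p) ⟨
    zj ℤ.* (sign f p ℤ.* s)        ≡⟨ cong (λ t → zj ℤ.* (sign f p ℤ.* t)) (ℤ.*-identityʳ s) ⟨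
    zj ℤ.* (sign f p ℤ.* (s ℤ.* 1ℤ)) ≡⟨ cong (zj ℤ.*_) (sign-◅◅ f p (e ◅ ε)) ⟨
    zj ℤ.* sign f (p ◅◅ (e ◅ ε))   ≡⟨ cong (zj ℤ.*_) (proj₂ (walk-sign i) q′ (p ◅◅ (e ◅ ε))) ⟩
    zj ℤ.* sgn (z i)               ∎
    where
    open ≡-Reasoning
    s = σ f j i
    zj = sgn (z j)

-- Passes from x to y by changing one component at a time.
componentwise : {A : Set} (_∼_ : Rel A 0ℓ) → Reflexive _∼_ → Transitive _∼_ →
  (h : State n → A) (x y : State n) →
  (∀ j w → h (w [ j ]≔ lookup x j) ∼ h (w [ j ]≔ lookup y j)) → h x ∼ h y
componentwise _∼_ rfl trn h []      []      step = rfl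
componentwise _∼_ rfl trn h (a ∷ x) (b ∷ y) step = trn
  (componentwise _∼_ rfl trn (h ∘ (a ∷_)) x y (λ j w → step (suc j) (a ∷ w)))
  (step zero (a ∷ y))

update-differs-at : (w : State n) (j : Fin n) {a b : Bool} → a ≢ b →
  DifferOnlyAt j (w [ j ]≔ a) (w [ j ]≔ b)
update-differs-at w j {a} {b} a≢b =
  (λ eq → a≢b (trans (sym (lookup∘update j w a)) (trans eq (lookup∘update j w b)))) ,
  (λ k k≢j → trans (lookup∘update′ k≢j w a) (sym (lookup∘update′ k≢j w b)))

-- Predecessor-closed sets and single flips

Closed : Network n → Subset n → Set
Closed f U = ∀ {j i} → Edge f j i → i ∈ U → j ∈ U

_≡[_]_ : State n → Subset n → State n → Set
x ≡[ U ] y = ∀ {k} → k ∈ U → lookup x k ≡ lookup y k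

-- Pass from `x` to `y` one component at a time. A change at `j` that alters `f` at `i` exhibits an
-- edge, so `j` is in `U`, where `x` and `y` agree.
closed-determines : (f : Network n) {U : Subset n} → Closed f U → {x y : State n} → x ≡[ U ] y →
  ∀ {i} → i ∈ U → lookup (f x) i ≡ lookup (f y) i
closed-determines f {U} closed {x} {y} agree {i} i∈U =
  componentwise _≡_ refl trans (λ z → lookup (f z) i) x y step
  where
  step : ∀ j w → lookup (f (w [ j ]≔ lookup x j)) i ≡ lookup (f (w [ j ]≔ lookup y j)) i
  step j w with lookup x j Bool.≟ lookup y j
  ... | yes eq = cong (λ a → lookup (f (w [ j ]≔ a)) i) eq
  ... | no  ne with lookup (f (w [ j ]≔ lookup x j)) i Bool.≟ lookup (f (w [ j ]≔ lookup y j)) i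
  ...   | yes eq  = eq
  ...   | no  ne′ = contradiction
    (agree (closed (w [ j ]≔ lookup x j , w [ j ]≔ lookup y j , update-differs-at w j ne , ne′) i∈U)) ne

update-flip : (w : State n) (j : Fin n) (a : Bool) → (w [ j ]≔ a) [ j ]%= not ≡ w [ j ]≔ not a
update-flip w j a = updateAt-updateAt j w

-- In coordinates switched by `a` at `j` and by `b` at `i`, going from `a` to `not a` is going from
-- `false` to `true`, and the edge sign multiplied by both switching signs is 1.
switched-mono : (f : Network n) {j i : Fin n} (a b : Bool) → σ f j i ≡ sgn a ℤ.* sgn b → ∀ w →
  lookup (f (w [ j ]≔ a)) i xor b ≤ᵇ lookup (f (w [ j ]≔ not a)) i xor b
switched-mono f {j} {i} a b s w = cases a b s
  where
  F : Bool → Bool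
  F c = lookup (f (w [ j ]≔ c)) i
  up : Nondecreasing f j i → F false ≤ᵇ F true
  up h = subst (λ y → F false ≤ᵇ lookup (f y) i) (update-flip w j false)
    (h (w [ j ]≔ false) (lookup∘update j w false))
  down : Nonincreasing f j i → F true ≤ᵇ F false
  down h = subst (λ y → lookup (f y) i ≤ᵇ F false) (update-flip w j false)
    (h (w [ j ]≔ false) (lookup∘update j w false))
  xor-false : ∀ {c d} → c ≤ᵇ d → c xor false ≤ᵇ d xor false
  xor-false f≤t = f≤t
  xor-false b≤b = b≤b
  xor-true : ∀ {c d} → c ≤ᵇ d → d xor true ≤ᵇ c xor true
  xor-true f≤t = f≤t
  xor-true b≤b = b≤b
  cases : ∀ a b → σ f j i ≡ sgn a ℤ.* sgn b → F a xor b ≤ᵇ F (not a) xor b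
  cases false false s = xor-false (up (σ≡1⇒nondecreasing f s))
  cases false true  s = xor-true (down (σ≡-1⇒nonincreasing f s))
  cases true  false s = xor-false (down (σ≡-1⇒nonincreasing f s))
  cases true  true  s = xor-true (up (σ≡1⇒nondecreasing f s))

-- Simulation of a component by a monotone network

merge : Subset n → (Fin n → Bool) → State n → State n
merge C h x = tabulate λ k → if lookup C k then h k else lookup x k

module _ (C : Subset n) (h : Fin n → Bool) (x : State n) where

  merge-∈ : ∀ {k} → k ∈ C → lookup (merge C h x) k ≡ h k
  merge-∈ {k} k∈C = trans (lookup∘tabulate _ k)
    (cong (if_then h k else lookup x k) ([]=⇒lookup k∈C))

  merge-∉ : ∀ {k} → k ∉ C → lookup (merge C h x) k ≡ lookup x k
  merge-∉ {k} k∉C = trans (lookup∘tabulate _ k)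
    (cong (if_then h k else lookup x k) (Bool.¬-not (k∉C ∘ lookup⇒[]= k C)))

xor-cancel : ∀ a b → (a xor b) xor b ≡ a
xor-cancel false b = Bool.xor-same b
xor-cancel true  b = trans (sym (Bool.not-distribˡ-xor b b)) (cong not (Bool.xor-same b))

-- Common interface for the ways to settle a component: `W` satisfies it for every `C`, a complete
-- word repeated twice when `C` has at most two vertices, a complete word when `C` has one.
FixesMonotoneOn : Subset n → Word n → Set
FixesMonotoneOn {n} C w =
  ∀ (g : Network n) → Monotone g → (∀ i → i ∉ C → ∀ x → Stable g i x) → Fixes w g

-- With the inputs from U frozen at x, switching by z turns f on C into the
-- monotone network g, and a run of f is the switched image of a run of g.
module Switching (f : Network n) (C : Subset n) (z : Fin n → Bool)
  (switches : ∀ {j i} → j ∈ C → i ∈ C → Edge f j i → σ f j i ≡ sgn (z j) ℤ.* sgn (z i))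
  (x : State n) where

  unswitch : State n → State n
  unswitch y = merge C (λ k → lookup y k xor z k) x

  g : Network n
  g y = merge C (λ i → lookup (f (unswitch y)) i xor z i) y

  g-idle : ∀ i → i ∉ C → ∀ y → Stable g i y
  g-idle i i∉C y = merge-∉ C _ y i∉C

  g-monotone : Monotone g
  g-monotone {y} {y′} y≼y′ = extensional⇒inductive (ext le)
    where
    u  = unswitch y
    u′ = unswitch y′
    le : ∀ i → lookup (g y) i ≤ᵇ lookup (g y′) i
    le i with i ∈? C
    ... | no i∉C = subst₂ _≤ᵇ_ (sym (g-idle i i∉C y)) (sym (g-idle i i∉C y′))
                     (Pointwise.lookup y≼y′ i)
    ... | yes i∈C = subst₂ _≤ᵇ_ (sym (merge-∈ C _ y i∈C)) (sym (merge-∈ C _ y′ i∈C))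
                      (componentwise _≤ᵇ_ Bool.≤-refl Bool.≤-trans h u u′ step)
      where
      h : State _ → Bool
      h w = lookup (f w) i xor z i
      step : ∀ j w → h (w [ j ]≔ lookup u j) ≤ᵇ h (w [ j ]≔ lookup u′ j)
      step j w with j ∈? C
      ... | no j∉C rewrite merge-∉ C (λ k → lookup y k xor z k) x j∉C
                         | merge-∉ C (λ k → lookup y′ k xor z k) x j∉C = Bool.≤-refl
      ... | yes j∈C rewrite merge-∈ C (λ k → lookup y k xor z k) x j∈C
                          | merge-∈ C (λ k → lookup y′ k xor z k) x j∈C
        = raise (Pointwise.lookup y≼y′ j)
        where
        F : Bool → Bool
        F a = lookup (f (w [ j ]≔ a)) i
        raise : ∀ {a b} → a ≤ᵇ b → h (w [ j ]≔ (a xor z j)) ≤ᵇ h (w [ j ]≔ (b xor z j))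
        raise b≤b = Bool.≤-refl
        -- Either the flip at `j` does not affect `f` at `i`, or it witnesses an edge, whose sign is
        -- known from `switches`.
        raise f≤t with F (z j) Bool.≟ F (not (z j))
        ... | yes eq rewrite eq = Bool.≤-refl
        ... | no ne = switched-mono f (z j) (z i)
          (switches j∈C i∈C (w [ j ]≔ z j , w [ j ]≔ not (z j) , update-differs-at w j (Bool.not-¬ refl) , ne)) w

  module _ {U : Subset n} (closed-U : Closed f U) (closed-UC : Closed f (U ∪ C))
    (settled : ∀ {i} → i ∈ U → Stable f i x) where

    -- a is a state of f, y one of g
    Matches : State n → State n → Set
    Matches a y = (a ≡[ U ] x) × (∀ {k} → k ∈ C → lookup a k ≡ lookup y k xor z k)

    matches-unswitch : ∀ a y → Matches a y → a ≡[ U ∪ C ] unswitch y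
    matches-unswitch a y (onU , onC) {k} k∈ with k ∈? C
    ... | yes k∈C = trans (onC k∈C) (sym (merge-∈ C _ x k∈C))
    ... | no  k∉C with x∈p∪q⁻ U C k∈
    ...   | inj₁ k∈U = trans (onU k∈U) (sym (merge-∉ C _ x k∉C))
    ...   | inj₂ k∈C = contradiction k∈C k∉C

    matches-f : ∀ a y → Matches a y → ∀ {i} → i ∈ C → lookup (f a) i ≡ lookup (g y) i xor z i
    matches-f a y m {i} i∈C = begin
      lookup (f a) i
        ≡⟨ closed-determines f closed-UC (matches-unswitch a y m) (x∈p∪q⁺ (inj₂ i∈C)) ⟩
      lookup (f (unswitch y)) i                    ≡⟨ xor-cancel _ (z i) ⟨
      (lookup (f (unswitch y)) i xor z i) xor z i  ≡⟨ cong (_xor z i) (merge-∈ C _ y i∈C) ⟨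
      lookup (g y) i xor z i                       ∎
      where open ≡-Reasoning

    -- On `U` an update changes nothing, because `f` there depends on `U` only and `x` is stable
    -- there. On `C` both networks compute matching values. Letters outside `U ∪ C` touch neither
    -- condition.
    matches-update : ∀ i a y → Matches a y → Matches (update f i a) (update g i y)
    matches-update i a y m@(onU , onC) = onU′ , onC′
      where
      onU′ : update f i a ≡[ U ] x
      onU′ {k} k∈U with k ≟ i
      ... | yes refl = trans (lookup∘update k a _)
                         (trans (closed-determines f closed-U onU k∈U) (settled k∈U))
      ... | no  k≢i  = trans (lookup∘update′ k≢i a _) (onU k∈U)
      onC′ : ∀ {k} → k ∈ C → lookup (update f i a) k ≡ lookup (update g i y) k xor z k
      onC′ {k} k∈C with k ≟ i
      ... | yes refl rewrite lookup∘update k a (lookup (f a) k) | lookup∘update k y (lookup (g y) k)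
        = matches-f a y m k∈C
      ... | no  k≢i  rewrite lookup∘update′ k≢i a (lookup (f a) i) | lookup∘update′ k≢i y (lookup (g y) i)
        = onC k∈C

    matches-run : ∀ w a y → Matches a y → Matches (run f w a) (run g w y)
    matches-run []      a y m = m
    matches-run (i ∷ w) a y m = matches-run w _ _ (matches-update i a y m)

    -- The run of `f` from `x` matches the run of `g` from the switched state `y₀`. The latter ends
    -- in a fixed point of `g`, and matching turns this into stability of `f` on `C`.
    run-settles : ∀ {w} → FixesMonotoneOn C w → ∀ {i} → i ∈ U ∪ C → Stable f i (run f w x)
    run-settles {w} fixes {i} i∈ = [ onU , onC ]′ (x∈p∪q⁻ U C i∈)
      where
      y₀ = tabulate λ k → lookup x k xor z k
      a = run f w x
      y = run g w y₀
      final : Matches a y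
      final = matches-run w x y₀ ((λ _ → refl) , λ {k} _ →
        sym (trans (cong (_xor z k) (lookup∘tabulate _ k)) (xor-cancel _ (z k))))
      onU : i ∈ U → Stable f i a
      onU i∈U = trans (closed-determines f closed-U (proj₁ final) i∈U)
        (trans (settled i∈U) (sym (proj₁ final i∈U)))
      onC : i ∈ C → Stable f i a
      onC i∈C = begin
        lookup (f a) i           ≡⟨ matches-f a y final i∈C ⟩
        lookup (g y) i xor z i   ≡⟨ cong (λ v → lookup v i xor z i) (fixes g g-monotone g-idle y₀) ⟩
        lookup y i xor z i       ≡⟨ proj₂ final i∈C ⟨
        lookup a i               ∎
        where open ≡-Reasoning

-- Settling the components in topological order

comprehension : {P : Fin n → Set} → Decidable P → Subset n
comprehension P? = tabulate (does ∘ P?)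

module _ {P : Fin n → Set} (P? : Decidable P) where

  ∈-comprehension⁺ : ∀ {i} → P i → i ∈ comprehension P?
  ∈-comprehension⁺ {i} p = lookup⇒[]= i _ (trans (lookup∘tabulate _ i) (dec-true (P? i) p))

  ∈-comprehension⁻ : ∀ {i} → i ∈ comprehension P? → P i
  ∈-comprehension⁻ {i} i∈ = decidable-stable (P? i) λ ¬p →
    contradiction (trans (sym ([]=⇒lookup i∈)) (trans (lookup∘tabulate _ i) (dec-false (P? i) ¬p))) λ ()

-- The elements of `xs` join `p` one by one, each enlarging it. This counts newly settled vertices
-- and also bounds the length of cycles.
length+∣p∣≤∣q∣ : {p q : Subset n} → p ⊆ q → (xs : List (Fin n)) → Unique xs →
  All (λ x → x ∈ q × x ∉ p) xs → length xs + ∣ p ∣ ≤ ∣ q ∣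
length+∣p∣≤∣q∣ p⊆q [] [] [] = p⊆q⇒∣p∣≤∣q∣ p⊆q
length+∣p∣≤∣q∣ {p = p} {q} p⊆q (x ∷ xs) (x∉xs ∷ uniq) ((x∈q , x∉p) ∷ new) = begin
  suc (length xs + ∣ p ∣)        ≡⟨ ℕ.+-suc (length xs) ∣ p ∣ ⟨
  length xs + suc ∣ p ∣
    ≤⟨ ℕ.+-monoʳ-≤ (length xs)
         (p⊂q⇒∣p∣<∣q∣ (p⊆p∪q ⁅ x ⁆ , x , x∈p∪q⁺ (inj₂ (x∈⁅x⁆ x)) , x∉p)) ⟩
  length xs + ∣ p ∪ ⁅ x ⁆ ∣      ≤⟨ length+∣p∣≤∣q∣ p′⊆q xs uniq (All.zipWith new′ (x∉xs , new)) ⟩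
  ∣ q ∣                          ∎
  where
  open ℕ.≤-Reasoning
  p′⊆q : p ∪ ⁅ x ⁆ ⊆ q
  p′⊆q y∈ = [ p⊆q , (λ y∈x → subst (_∈ q) (sym (x∈⁅y⁆⇒x≡y x y∈x)) x∈q) ]′ (x∈p∪q⁻ p ⁅ x ⁆ y∈)
  new′ : ∀ {y} → x ≢ y × (y ∈ q × y ∉ p) → y ∈ q × y ∉ p ∪ ⁅ x ⁆
  new′ (x≢y , y∈q , y∉p) = y∈q , λ y∈ →
    [ y∉p , x≢y ∘ sym ∘ x∈⁅y⁆⇒x≡y x ]′ (x∈p∪q⁻ p ⁅ x ⁆ y∈)

full : {U : Subset n} → n ≤ ∣ U ∣ → ∀ i → i ∈ U
full {U = U} n≤ i = subst (i ∈_) (sym (∣p∣≡n⇒p≡⊤ (ℕ.≤-antisym (∣p∣≤n U) n≤))) ∈⊤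

missing : {U : Subset n} → ∣ U ∣ < n → ∃[ i ] i ∉ U
missing {n} {U} U<n with any? (λ i → ¬? (i ∈? U))
... | yes found = found
... | no  none  = contradiction U<n (ℕ.≤⇒≯ (subst (_≤ ∣ U ∣) (∣⊤∣≡n n)
  (p⊆q⇒∣p∣≤∣q∣ {p = ⊤} λ {i} _ → decidable-stable (i ∈? U) λ i∉U → none (i , i∉U))))

-- Double negation commutes with products over the finite set of pairs, so excluded middle can be
-- used for all pairs at once.
¬¬-decidable : (R : Fin n → Fin n → Set) → ¬ ¬ (∀ u v → Dec (R u v))
¬¬-decidable R = sequence A λ u → sequence A λ v → ¬¬-excluded-middle
  where A = RawMonad.rawApplicative ¬¬-Monad

module Components (f : Network n) (bal : Balanced f) (walk? : ∀ u v → Dec (Walk f u v)) where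

  _⊏_ : Fin n → Fin n → Set
  u ⊏ v = Walk f u v × ¬ Walk f v u

  ⊏-isStrictPartialOrder : IsStrictPartialOrder _≡_ _⊏_
  ⊏-isStrictPartialOrder = record
    { isEquivalence = isEquivalence
    ; irrefl = λ { refl (p , ¬p) → ¬p p }
    ; trans = λ (p , _) (q , ¬q) → p ◅◅ q , λ r → ¬q (r ◅◅ p)
    ; <-resp-≈ = (λ { refl p → p }) , (λ { refl p → p })
    }

  -- By `closed-U∪C`, all predecessors of `C` outside `C` lie in `U`: this component may come next
  -- in a topological order.
  record Component (U : Subset n) : Set where
    field
      root       : Fin n
      C          : Subset n
      root∈C     : root ∈ C
      strong     : ∀ {i} → i ∈ C → Strong f root i
      disjoint   : ∀ {i} → i ∈ C → i ∉ U
      closed-U∪C : Closed f (U ∪ C)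

  closed-walk : ∀ {U u v} → Closed f U → Walk f u v → v ∈ U → u ∈ U
  closed-walk closed ε       v∈U = v∈U
  closed-walk closed (e ◅ p) v∈U = closed e (closed-walk closed p v∈U)

  -- Descends along strict reachability outside `U`, which is well-founded since there are finitely
  -- many vertices.
  minimal : ∀ U {v} → v ∉ U → Acc _⊏_ v → ∃[ r ] (r ∉ U × (∀ {u} → u ∉ U → Walk f u r → Walk f r u))
  minimal U {v} v∉U (acc rs) with any? (λ u → ¬? (u ∈? U) ×-dec (walk? u v ×-dec ¬? (walk? v u)))
  ... | yes (u , u∉U , u⊏v) = minimal U u∉U (rs u⊏v)
  ... | no  none = v , v∉U , λ {u} u∉U p →
    decidable-stable (walk? v u) λ ¬q → none (u , u∉U , p , ¬q)

  component : ∀ {U} → Closed f U → ∣ U ∣ < n → Component U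
  component {U} closed U<n
    with v , v∉U ← missing U<n
    with r , r∉U , min ← minimal U v∉U (spo-wellFounded ⊏-isStrictPartialOrder v)
    = record
    { root = r ; C = C ; root∈C = ∈-comprehension⁺ C? (ε , ε) ; strong = ∈-comprehension⁻ C?
    ; disjoint = λ i∈C i∈U → r∉U (closed-walk closed (proj₁ (∈-comprehension⁻ C? i∈C)) i∈U)
    ; closed-U∪C = closed-U∪C }
    where
    C? : Decidable (Strong f r)
    C? i = walk? r i ×-dec walk? i r
    C = comprehension C?
    closed-U∪C : Closed f (U ∪ C)
    closed-U∪C {j} {i} e i∈ with x∈p∪q⁻ U C i∈ | j ∈? U
    ... | _        | yes j∈U = x∈p∪q⁺ (inj₁ j∈U)
    ... | inj₁ i∈U | no  j∉U = contradiction (closed e i∈U) j∉U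
    -- A predecessor of `C` outside `U` reaches `r`, so by minimality `r` reaches it too and it
    -- belongs to `C`.
    ... | inj₂ i∈C | no  j∉U = x∈p∪q⁺ (inj₂ (∈-comprehension⁺ C? (min j∉U j⇝r , j⇝r)))
      where j⇝r = e ◅ proj₂ (∈-comprehension⁻ C? i∈C)

  StableOn : Subset n → State n → Set
  StableOn U x = ∀ {i} → i ∈ U → Stable f i x

  -- `k` is a lower bound only, so a block can be credited with three vertices even when it settles
  -- more.
  Settled : ℕ → State n → Set
  Settled k x = ∃[ U ] (Closed f U × StableOn U x × k ≤ ∣ U ∣)

  -- `f` on a closed `U` depends on `U` only, so no later update can disturb vertices of `U` that
  -- are stable.
  run-stable : ∀ {U} → Closed f U → ∀ w {x} → StableOn U x → StableOn U (run f w x)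
  run-stable closed [] stable = stable
  run-stable {U} closed (i ∷ w) {x} stable = run-stable closed w stable′
    where
    y = update f i x
    agree : y ≡[ U ] x
    agree {j} j∈U with j ≟ i
    ... | yes refl = trans (lookup∘update j x _) (stable j∈U)
    ... | no  j≢i  = lookup∘update′ j≢i x _
    stable′ : StableOn U y
    stable′ j∈U = trans (closed-determines f closed agree j∈U) (trans (stable j∈U) (sym (agree j∈U)))

  run-settled : ∀ {k} w {x} → Settled k x → Settled k (run f w x)
  run-settled w (U , closed , stable , k≤) = U , closed , run-stable closed w stable , k≤

  settle-component : ∀ {U x k} → Closed f U → StableOn U x → (comp : Component U) →
    let open Component comp in
    ∀ w → FixesMonotoneOn C w → k ≤ ∣ U ∪ C ∣ → Settled k (run f w x)
  settle-component {U} {x} closed stable comp w fixes k≤ = U ∪ C , closed-U∪C , stable′ , k≤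
    where
    open Component comp
    zp = potential f bal walk? root
    stable′ : StableOn (U ∪ C) (run f w x)
    stable′ = Switching.run-settles f C (proj₁ zp)
      (λ j∈C i∈C → proj₂ zp (strong j∈C) (strong i∈C)) x closed closed-U∪C stable {w} fixes

  fixed : ∀ {x} → Settled n x → f x ≡ x
  fixed (U , _ , stable , n≤) = stable⇒fixed f λ i → stable (full n≤ i)

  module Blocks (s : Word n) (s-complete : ∀ i → i List.∈ s) (W : Word n) (W-fixes : FixesAll Monotone W) where

    data Growth (U C : Subset n) : Set where
      single : FixesMonotoneOn C s → 1 + ∣ U ∣ ≤ ∣ U ∪ C ∣ → Growth U C
      pair   : FixesMonotoneOn C (s ++ s) → 2 + ∣ U ∣ ≤ ∣ U ∪ C ∣ → Growth U C
      large  : 3 + ∣ U ∣ ≤ ∣ U ∪ C ∣ → Growth U C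

    growth : ∀ {U} (comp : Component U) → Growth U (Component.C comp)
    growth {U} comp = go
      where
      open Component comp renaming (root to r; root∈C to r∈C)
      new : ∀ {i} → i ∈ C → i ∈ U ∪ C × i ∉ U
      new i∈C = x∈p∪q⁺ (inj₂ i∈C) , disjoint i∈C
      go : Growth U C
      go with any? (λ a → a ∈? C ×-dec ¬? (a ≟ r))
      ... | no none = single
        (λ g mono idle → word-fixes-single mono r
          (λ i i≢r → idle i λ i∈C → none (i , i∈C , i≢r)) s (s-complete r))
        (length+∣p∣≤∣q∣ (p⊆p∪q C) (r ∷ []) ([] ∷ []) (new r∈C ∷ []))
      ... | yes (a , a∈C , a≢r) with any? (λ b → b ∈? C ×-dec (¬? (b ≟ r) ×-dec ¬? (b ≟ a)))
      ...   | no none = pair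
        (λ g mono idle → square-fixes-pair mono r a
          (λ i i≢r i≢a → idle i λ i∈C → none (i , i∈C , i≢r , i≢a)) s (s-complete r) (s-complete a))
        (length+∣p∣≤∣q∣ (p⊆p∪q C) (a ∷ r ∷ []) ((a≢r ∷ []) ∷ [] ∷ []) (new a∈C ∷ new r∈C ∷ []))
      ...   | yes (b , b∈C , b≢r , b≢a) = large
        (length+∣p∣≤∣q∣ (p⊆p∪q C) (b ∷ a ∷ r ∷ []) ((b≢a ∷ b≢r ∷ []) ∷ (a≢r ∷ []) ∷ [] ∷ [])
          (new b∈C ∷ new a∈C ∷ new r∈C ∷ []))

    -- What can settle the next component, by its size. The arbitrary `w` before `W` is harmless
    -- because it keeps `U` settled. The bounds by `n` rule out components too large for the
    -- vertices that remain at the end.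
    data Progress (k : ℕ) (x : State n) : Set where
      complete : Settled n x → Progress k x
      single   : Settled (1 + k) (run f s x) → Settled (1 + k) (run f W x) → Progress k x
      pair     : 2 + k ≤ n → Settled (2 + k) (run f s (run f s x)) →
                 (∀ w → Settled (2 + k) (run f W (run f w x))) → Progress k x
      large    : 3 + k ≤ n → (∀ w → Settled (3 + k) (run f W (run f w x))) → Progress k x

    progress : ∀ {k x} → Settled k x → Progress k x
    progress {k} {x} (U , closed , stable , k≤) with n ℕ.≤? ∣ U ∣
    ... | yes n≤ = complete (U , closed , stable , n≤)
    ... | no  n≰ = go (growth comp)
      where
      comp = component closed (ℕ.≰⇒> n≰)
      open Component comp
      bound : ∀ {c} → c + ∣ U ∣ ≤ ∣ U ∪ C ∣ → c + k ≤ ∣ U ∪ C ∣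
      bound {c} = ℕ.≤-trans (ℕ.+-monoʳ-≤ c k≤)
      W-settles : ∀ {c} → c + ∣ U ∣ ≤ ∣ U ∪ C ∣ → ∀ w → Settled (c + k) (run f W (run f w x))
      W-settles {c} ≤U∪C w =
        settle-component closed (run-stable closed w stable) comp W (λ g mono _ → W-fixes g mono) (bound {c} ≤U∪C)
      go : Growth U C → Progress k x
      go (single fx 1+) = single (settle-component closed stable comp s fx (bound {1} 1+)) (W-settles {1} 1+ [])
      go (pair fx 2+) = pair (ℕ.≤-trans (bound {2} 2+) (∣p∣≤n (U ∪ C)))
        (subst (Settled (2 + k)) (run-++ f s s x)
          (settle-component closed stable comp (s ++ s) fx (bound {2} 2+)))
        (W-settles {2} 2+)
      go (large 3+) = large (ℕ.≤-trans (bound {3} 3+) (∣p∣≤n (U ∪ C))) (W-settles {3} 3+)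

    weaken : ∀ {k m x} → k ≤ m → Settled m x → Settled k x
    weaken k≤m (U , closed , stable , m≤) = U , closed , stable , ℕ.≤-trans k≤m m≤

    W-grows : ∀ {k x} → 1 + k ≤ n → Settled k x → Settled (1 + k) (run f W x)
    W-grows k<n st with progress st
    ... | complete st′ = run-settled W (weaken k<n st′)
    ... | single _ st′   = st′
    ... | pair _ _ st′ = weaken (ℕ.n≤1+n _) (st′ [])
    ... | large _ st′  = weaken (ℕ.m≤n+m (1 + _) 2) (st′ [])

    sW-grows : ∀ {k x} → 2 + k ≤ n → Settled k x → Settled (2 + k) (run f W (run f s x))
    sW-grows k<n st with progress st
    ... | complete st′ = run-settled W (run-settled s (weaken k<n st′))
    ... | single st′ _ = W-grows k<n st′
    ... | pair _ _ st′ = st′ s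
    ... | large _ st′  = weaken (ℕ.n≤1+n _) (st′ s)

    -- A component of one vertex is settled by the first `s`, leaving two vertices to `sW-grows`;
    -- one of two vertices by both copies of `s`, leaving one vertex to `W`; a larger one by `W`.
    ssW-grows : ∀ {k x} → 3 + k ≤ n → Settled k x → Settled (3 + k) (run f (s ++ s ++ W) x)
    ssW-grows {k} {x} k<n st = subst (Settled (3 + k)) (sym eq) grows
      where
      eq : run f (s ++ s ++ W) x ≡ run f W (run f s (run f s x))
      eq = trans (run-++ f s (s ++ W) x) (run-++ f s W (run f s x))
      grows : Settled (3 + k) (run f W (run f s (run f s x)))
      grows with progress st
      ... | complete st′ = run-settled W (run-settled s (run-settled s (weaken k<n st′)))
      ... | single st′ _ = sW-grows k<n st′
      ... | pair _ st′ _ = W-grows k<n st′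
      ... | large _ st′  = subst (λ y → Settled (3 + k) (run f W y)) (run-++ f s s x) (st′ (s ++ s))

    blocks-grow : ∀ q {k x} → q * 3 + k ≤ n → Settled k x → Settled (q * 3 + k) (run f (q · (s ++ s ++ W)) x)
    blocks-grow zero k≤n st = st
    blocks-grow (suc q) {k} {x} k≤n st =
      subst₂ Settled (shift q) (sym (run-++ f (s ++ s ++ W) (q · (s ++ s ++ W)) x))
        (blocks-grow q (subst (_≤ n) (sym (shift q)) k≤n)
          (ssW-grows (ℕ.≤-trans (ℕ.m≤n+m (3 + k) (q * 3)) (subst (_≤ n) (sym (shift q)) k≤n)) st))
      where
      shift : ∀ q → q * 3 + (3 + k) ≡ 3 + q * 3 + k
      shift q = trans (sym (ℕ.+-assoc (q * 3) 3 k)) (cong (_+ k) (ℕ.+-comm (q * 3) 3))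

    -- At most one vertex is unaccounted for, so the cases `pair` and `large` contradict their
    -- bounds by `n`.
    s-completes : ∀ {k x} → n ≤ 1 + k → Settled k x → Settled n (run f s x)
    s-completes n≤ st with progress st
    ... | complete st′  = run-settled s st′
    ... | single st′ _  = weaken n≤ st′
    ... | pair k<n _ _  = contradiction (ℕ.≤-trans k<n n≤) ℕ.1+n≰n
    ... | large k<n _   = contradiction (ℕ.≤-trans (ℕ.<⇒≤ k<n) n≤) ℕ.1+n≰n

    ss-completes : ∀ {k x} → n ≤ 2 + k → Settled k x → Settled n (run f s (run f s x))
    ss-completes n≤ st with progress st
    ... | complete st′  = run-settled s (run-settled s st′)
    ... | single st′ _  = s-completes n≤ st′
    ... | pair _ st′ _  = weaken n≤ st′
    ... | large k<n _   = contradiction (ℕ.≤-trans k<n n≤) ℕ.1+n≰n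

    remainder-completes : ∀ r {k x} → r < 3 → n ≤ r + k → Settled k x → Settled n (run f (r · s) x)
    remainder-completes 0 _ n≤ st = weaken n≤ st
    remainder-completes 1 {x = x} _ n≤ st =
      subst (Settled n) (sym (run-++ f s [] x)) (s-completes n≤ st)
    remainder-completes 2 {x = x} _ n≤ st =
      subst (Settled n)
        (sym (trans (run-++ f s (s ++ []) x) (run-++ f s [] (run f s x)))) (ss-completes n≤ st)
    remainder-completes (suc (suc (suc _))) (s≤s (s≤s (s≤s ())))

W̃-fixes-balanced : ∀ (n q r : ℕ) → n ≡ 3 * q + r → r < 3 →
  (W : Word n) → FixesAll Monotone W → FixesAll Balanced (W̃ q r W)
W̃-fixes-balanced n q r n≡ r<3 W W-fixes f bal x =
  decidable-stable (≡-dec Bool._≟_ _ _) λ ¬fixed → ¬¬-decidable (Walk f) λ walk? →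
    ¬fixed (fixed-at walk?)
  where
  s = allFin n
  -- The count in the form in which it arises: 0 vertices at the start, three per block, then `r`.
  n≡′ : n ≡ r + (q * 3 + 0)
  n≡′ = trans n≡ (trans (ℕ.+-comm (3 * q) r) (cong (λ k → r + k) (trans (ℕ.*-comm 3 q) (sym (ℕ.+-identityʳ _)))))
  fixed-at : (∀ u v → Dec (Walk f u v)) → f (run f (W̃ q r W) x) ≡ run f (W̃ q r W) x
  fixed-at walk? = fixed (subst (Settled n) (sym (run-++ f (q · (s ++ s ++ W)) (r · s) x))
    (remainder-completes r r<3 (ℕ.≤-reflexive n≡′)
      (blocks-grow q (ℕ.≤-trans (ℕ.m≤n+m _ r) (ℕ.≤-reflexive (sym n≡′))) start)))
    where
    open Components f bal walk?
    open Blocks s ∈-allFin W W-fixes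
    start : Settled 0 x
    start = ∅ , (λ _ i∈ → contradiction i∈ ∉⊥) , (λ i∈ → contradiction i∈ ∉⊥) , z≤n

-- `σ` tests `Nondecreasing` first, and this holds for every pair of vertices, so all factors of a
-- cycle sign are 1. It yields the lower bound for balanced networks.
monotone⇒balanced : (f : Network n) → Monotone f → Balanced f
monotone⇒balanced f mono c _ = product-one (arcs c)
  where
  nondecreasing : ∀ j i → Nondecreasing f j i
  nondecreasing j i x xj≡false = Pointwise.lookup (mono (extensional⇒inductive (ext le))) i
    where
    le : ∀ k → lookup x k ≤ᵇ lookup (x [ j ]%= not) k
    le k with k ≟ j
    ... | yes refl rewrite xj≡false = Bool.≤-minimum _
    ... | no  k≢j  = Bool.≤-reflexive (sym (lookup∘updateAt′ k j k≢j x))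
  σ≡1 : ∀ j i → σ f j i ≡ 1ℤ
  σ≡1 j i = cong (if_then 1ℤ else (if does (nonincreasing? f j i) then -1ℤ else 0ℤ))
    (dec-true (nondecreasing? f j i) (nondecreasing j i))
  product-one : ∀ as → foldr ℤ._*_ 1ℤ (map (uncurry (σ f)) as) ≡ 1ℤ
  product-one [] = refl
  product-one ((j , i) ∷ as) = cong₂ ℤ._*_ (σ≡1 j i) (product-one as)

-- Invariance under pointwise equality of networks

module _ {f g : Network n} (f≗g : f ≗ g) where

  update-cong : ∀ i x → update f i x ≡ update g i x
  update-cong i x = cong (λ y → x [ i ]≔ lookup y i) (f≗g x)

  run-cong : ∀ w x → run f w x ≡ run g w x
  run-cong []      x = refl
  run-cong (i ∷ w) x = trans (run-cong w _) (cong (run g w) (update-cong i x))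

  fixes-resp : ∀ {w} → Fixes w f → Fixes w g
  fixes-resp {w} fixes x =
    trans (cong g (sym (run-cong w x)))
      (trans (sym (f≗g (run f w x))) (trans (fixes x) (run-cong w x)))

  edge-resp : ∀ {j i} → Edge f j i → Edge g j i
  edge-resp {j} {i} (x , y , differ , ne) =
    x , y , differ , subst₂ (λ a b → lookup a i ≢ lookup b i) (f≗g x) (f≗g y) ne

  nondecreasing-resp : ∀ {j i} → Nondecreasing f j i → Nondecreasing g j i
  nondecreasing-resp {j} {i} h x xj =
    subst₂ (λ a b → lookup a i ≤ᵇ lookup b i) (f≗g x) (f≗g (x [ j ]%= not)) (h x xj)

  nonincreasing-resp : ∀ {j i} → Nonincreasing f j i → Nonincreasing g j i
  nonincreasing-resp {j} {i} h x xj =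
    subst₂ (λ a b → lookup a i ≤ᵇ lookup b i) (f≗g (x [ j ]%= not)) (f≗g x) (h x xj)

σ-cong : {f g : Network n} → f ≗ g → ∀ j i → σ f j i ≡ σ g j i
σ-cong {f = f} {g} f≗g j i = cong₂ (λ a b → if a then 1ℤ else if b then -1ℤ else 0ℤ)
  (does-⇔ (mk⇔ (nondecreasing-resp f≗g) (nondecreasing-resp (sym ∘ f≗g)))
    (nondecreasing? f j i) (nondecreasing? g j i))
  (does-⇔ (mk⇔ (nonincreasing-resp f≗g) (nonincreasing-resp (sym ∘ f≗g)))
    (nonincreasing? f j i) (nonincreasing? g j i))

balanced-resp : {f g : Network n} → f ≗ g → Balanced f → Balanced g
balanced-resp {f = f} {g} f≗g bal c (uniq , edges) = trans
  (cong (foldr ℤ._*_ 1ℤ) (sym (map-cong (λ (j , i) → σ-cong f≗g j i) (arcs c))))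
  (bal c (uniq , All.map (edge-resp (sym ∘ f≗g)) edges))

-- Makes the search for a cycle of sign other than 1 finite.
unique-length : {xs : List (Fin n)} → Unique xs → length xs ≤ n
unique-length {n} {xs} uniq = subst₂ _≤_
  (trans (cong (λ k → length xs + k) (∣⊥∣≡0 n)) (ℕ.+-identityʳ _)) (∣⊤∣≡n n)
  (length+∣p∣≤∣q∣ {p = ∅} {⊤} (λ i∈ → contradiction i∈ ∉⊥) xs uniq
    (All.universal (λ _ → ∈⊤ , ∉⊥) xs))

-- Exhaustive search

wordOfLength? : ∀ ℓ {P : Word n → Set} → Decidable P → Dec (∃[ w ] (length w ≡ ℓ × P w))
wordOfLength? zero P? = map′ (λ p → [] , refl , p) (λ { ([] , _ , p) → p }) (P? [])
wordOfLength? (suc ℓ) P? = map′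
  (λ (i , w , eq , p) → i ∷ w , cong suc eq , p)
  (λ { (i ∷ w , eq , p) → i , w , ℕ.suc-injective eq , p })
  (any? λ i → wordOfLength? ℓ (λ w → P? (i ∷ w)))

edge? : (f : Network n) → ∀ j i → Dec (Edge f j i)
edge? f j i = anySubset? λ x → anySubset? λ y →
  (¬? (lookup x j Bool.≟ lookup y j) ×-dec
   all? λ k → ¬? (k ≟ j) →-dec (lookup x k Bool.≟ lookup y k))
  ×-dec ¬? (lookup (f x) i Bool.≟ lookup (f y) i)

isCycle? : (f : Network n) → Decidable (IsCycle f)
isCycle? f c = allPairs? (λ i j → ¬? (i ≟ j)) (toList c) ×-dec
  All.all? (λ (j , i) → edge? f j i) (arcs c)

balanced? : (f : Network n) → Dec (Balanced f)
balanced? {n} f = map′ from to (¬? (ℕ.anyUpTo? (λ ℓ → any? λ v → wordOfLength? ℓ λ vs → bad? (v ∷ vs)) n))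
  where
  Bad : List⁺ (Fin n) → Set
  Bad c = IsCycle f c × cycleSign f c ≢ 1ℤ
  bad? : Decidable Bad
  bad? c = isCycle? f c ×-dec ¬? (cycleSign f c ℤ.≟ 1ℤ)
  BadOfLength : ℕ → Set
  BadOfLength ℓ = ∃[ v ] ∃[ vs ] (length vs ≡ ℓ × Bad (v ∷ vs))
  from : ¬ (∃[ ℓ ] (ℓ < n × BadOfLength ℓ)) → Balanced f
  from none (v ∷ vs) cyc = decidable-stable (_ ℤ.≟ _) λ ≢1 →
    -- The cycle has one vertex more than `vs`, hence the strict bound `length vs < n`.
    none (length vs , unique-length (proj₁ cyc) , v , vs , refl , cyc , ≢1)
  to : Balanced f → ¬ (∃[ ℓ ] (ℓ < n × BadOfLength ℓ))
  to bal (_ , _ , v , vs , _ , cyc , ≢1) = ≢1 (bal (v ∷ vs) cyc)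

-- Up to `≗`, every function on `State (suc m)` is a `join`, which lets the exhaustive search
-- recurse on `m`.
join : {A : Set} → (State m → A) → (State m → A) → State (suc m) → A
join f g (false ∷ x) = f x
join f g (true  ∷ x) = g x

-- Without function extensionality only predicates that respect ≗ can be decided.
allFunctions? : ∀ m {P : (State m → State n) → Set} → (∀ {f g} → f ≗ g → P f → P g) →
  Decidable P → Dec (∀ f → P f)
allFunctions? zero resp P? = map′
  (λ h f → resp (λ { [] → refl }) (h (f []))) (λ h x → h (const x)) (allState? (P? ∘ const))
allFunctions? (suc m) resp P? = map′
  (λ h f → resp (λ { (false ∷ x) → refl ; (true ∷ x) → refl }) (h (f ∘ (false ∷_)) (f ∘ (true ∷_))))
  (λ h f g → h (join f g))
  (allFunctions? m
    (λ eq h g → resp (λ { (false ∷ x) → eq x ; (true ∷ x) → refl }) (h g))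
    λ f → allFunctions? m
      (λ eq → resp (λ { (false ∷ x) → refl ; (true ∷ x) → eq x }))
      λ g → P? (join f g))

fixesAllBalanced? : Decidable (FixesAll {n} Balanced)
fixesAllBalanced? {n} w = allFunctions? n
  (λ f≗g h bal → fixes-resp f≗g {w} (h (balanced-resp (sym ∘ f≗g) bal)))
  λ f → balanced? f →-dec allState? λ x → ≡-dec Bool._≟_ _ _

least : {P : ℕ → Set} → Decidable P → ∀ m → P m → ∃[ ℓ ] (P ℓ × ∀ k → P k → ℓ ≤ k)
least {P} P? = <-rec _ λ m rec pm → search m rec pm
  where
  search : ∀ m → (∀ {k} → k < m → P k → ∃[ ℓ ] (P ℓ × ∀ j → P j → ℓ ≤ j)) →
    P m → ∃[ ℓ ] (P ℓ × ∀ k → P k → ℓ ≤ k)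
  search m rec pm with ℕ.anyUpTo? P? m
  ... | yes (k , k<m , pk) = rec k<m pk
  ... | no  none = m , pm , λ k pk → ℕ.≮⇒≥ λ k<m → none (k , k<m , pk)

shortest : {P : Network n → Set} → Decidable (FixesAll P) → ∀ w → FixesAll P w →
  ∃[ w′ ] IsShortestFixing P w′
shortest fixes? w fixes
  with _ , (w′ , refl , fixes′) , minimal ← least (λ ℓ → wordOfLength? ℓ fixes?) (length w) (w , refl , fixes)
  = w′ , fixes′ , λ v fixes″ → minimal (length v) (v , refl , fixes″)

-- Length bounds

length-· : ∀ k (u : Word n) → length (k · u) ≡ k * length u
length-· zero    u = refl
length-· (suc k) u = trans (length-++ u) (cong (λ k → length u + k) (length-· k u))

length-W̃ : ∀ q r (W : Word n) → length (W̃ q r W) ≡ q * (n + (n + length W)) + r * n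
length-W̃ {n} q r W = begin
  length (q · (s ++ s ++ W) ++ r · s)                     ≡⟨ length-++ (q · (s ++ s ++ W)) ⟩
  length (q · (s ++ s ++ W)) + length (r · s)             ≡⟨ cong₂ _+_ (length-· q (s ++ s ++ W)) (length-· r s) ⟩
  q * length (s ++ s ++ W) + r * length s                
    ≡⟨ cong (λ l → q * l + r * length s)
         (trans (length-++ s) (cong (λ k → length s + k) (length-++ s))) ⟩
  q * (length s + (length s + length W)) + r * length s  
    ≡⟨ cong (λ l → q * (l + (l + length W)) + r * l) (length-tabulate {n = n} (λ i → i)) ⟩
  q * (n + (n + length W)) + r * n                        ∎
  where
  open ≡-Reasoning
  s = allFin n

-- Multiplied by 3 to stay in the naturals. It rests on `3 * q ≤ n` and on 3n = 9q + 3r, which is at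
-- least 6q + 3r.
length-W̃-bound : ∀ n q r (W : Word n) → n ≡ 3 * q + r →
  length (W̃ q r W) * 3 ≤ n * length W + n ^ 2 * 3
length-W̃-bound n q r W n≡ = begin
  length (W̃ q r W) * 3                          ≡⟨ cong (_* 3) (length-W̃ q r W) ⟩
  (q * (n + (n + L)) + r * n) * 3               ≡⟨ expand q r n L ⟩
  3 * q * L + (6 * q + 3 * r) * n               ≤⟨ ℕ.+-mono-≤ (ℕ.*-monoˡ-≤ L 3q≤n) (ℕ.*-monoˡ-≤ n 6q+3r≤3n) ⟩
  n * L + (n * 3) * n                           ≡⟨ collect n L ⟩
  n * L + n ^ 2 * 3                             ∎
  where
  open ℕ.≤-Reasoning
  L = length W
  expand : ∀ q r n L → (q * (n + (n + L)) + r * n) * 3 ≡ 3 * q * L + (6 * q + 3 * r) * n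
  expand = ℕ-Solver.solve-∀
  -- `n * (n * 1)` is what `n ^ 2` unfolds to.
  collect : ∀ n L → n * L + (n * 3) * n ≡ n * L + n * (n * 1) * 3
  collect = ℕ-Solver.solve-∀
  split-3n : ∀ q r → (3 * q + r) * 3 ≡ 6 * q + 3 * r + 3 * q
  split-3n = ℕ-Solver.solve-∀
  3q≤n : 3 * q ≤ n
  3q≤n = subst (3 * q ≤_) (sym n≡) (ℕ.m≤m+n (3 * q) r)
  6q+3r≤3n : 6 * q + 3 * r ≤ n * 3
  6q+3r≤3n = subst (6 * q + 3 * r ≤_) (sym (trans (cong (_* 3) n≡) (split-3n q r))) (ℕ.m≤m+n _ (3 * q))

-- In unnormalised rationals n/3 keeps its denominator 3 (stored as 2), and the comparison is
-- cross-multiplication in the integers, which `lhs` and `rhs` match with the hypothesis.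
ℚ-bound : ∀ a n L b → a * 3 ≤ n * L + b * 3 →
  (+ a / 1) ℚ.≤ (+ n / 3) ℚ.* (+ L / 1) ℚ.+ (+ b / 1)
ℚ-bound a n L b le = ℚ.toℚᵘ-cancel-≤ (begin
  ℚ.toℚᵘ (+ a / 1)                                                   ≃⟨ ℚ.toℚᵘ-fromℚᵘ (mkℚᵘ (+ a) 0) ⟩
  mkℚᵘ (+ a) 0                                                       ≤⟨ *≤* (subst₂ ℤ._≤_ lhs rhs (ℤ.+≤+ le)) ⟩
  mkℚᵘ (+ n) 2 ℚᵘ.* mkℚᵘ (+ L) 0 ℚᵘ.+ mkℚᵘ (+ b) 0
    ≃⟨ ℚᵘ.+-cong (ℚᵘ.*-cong (ℚ.toℚᵘ-fromℚᵘ (mkℚᵘ (+ n) 2)) (ℚ.toℚᵘ-fromℚᵘ (mkℚᵘ (+ L) 0)))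
                 (ℚ.toℚᵘ-fromℚᵘ (mkℚᵘ (+ b) 0)) ⟨
  ℚ.toℚᵘ (+ n / 3) ℚᵘ.* ℚ.toℚᵘ (+ L / 1) ℚᵘ.+ ℚ.toℚᵘ (+ b / 1)
    ≃⟨ ℚᵘ.+-congˡ (ℚ.toℚᵘ (+ b / 1)) (ℚ.toℚᵘ-homo-* (+ n / 3) (+ L / 1)) ⟨
  ℚ.toℚᵘ ((+ n / 3) ℚ.* (+ L / 1)) ℚᵘ.+ ℚ.toℚᵘ (+ b / 1)
    ≃⟨ ℚ.toℚᵘ-homo-+ ((+ n / 3) ℚ.* (+ L / 1)) (+ b / 1) ⟨
  ℚ.toℚᵘ ((+ n / 3) ℚ.* (+ L / 1) ℚ.+ (+ b / 1))                      ∎)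
  where
  open ℚᵘ.≤-Reasoning
  lhs : + (a * 3) ≡ + a ℤ.* + 3
  lhs = ℤ.pos-* a 3
  rhs : + (n * L + b * 3) ≡ ((+ n ℤ.* + L) ℤ.* + 1 ℤ.+ + b ℤ.* + 3) ℤ.* + 1
  rhs = trans (cong₂ ℤ._+_ (trans (ℤ.pos-* n L) (sym (ℤ.*-identityʳ (+ n ℤ.* + L)))) (ℤ.pos-* b 3))
    (sym (ℤ.*-identityʳ ((+ n ℤ.* + L) ℤ.* + 1 ℤ.+ + b ℤ.* + 3)))

theorem14 : ∀ (n q r : ℕ) → 1 ≤ n → n ≡ 3 * q + r → r < 3 →
    (W : Word n) → IsShortestFixing Monotone W →
    FixesAll Balanced (W̃ q r W) ×
    (∃[ λM ] ∃[ λB ]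
    (IsMinFixingLength {n} Monotone λM × IsMinFixingLength {n} Balanced λB ×
    λM ≤ λB ×
    (+ λB / 1) ℚ.≤ (+ n / 3) ℚ.* (+ λM / 1) ℚ.+ (+ (n ^ 2) / 1)))
theorem14 n q r _ n≡ r<3 W W-shortest@(W-fixes , W-minimal) =
  W̃-fixes , length W , length B ,
  (W , W-shortest , refl) , (B , B-shortest , refl) ,
  -- `B` fixes monotone networks too, as they are balanced, so it is at least as long as `W`.
  W-minimal B (λ f mono → proj₁ B-shortest f (monotone⇒balanced f mono)) ,
  ℚ-bound (length B) n (length W) (n ^ 2) (ℕ.≤-trans
    (ℕ.*-monoˡ-≤ 3 (proj₂ B-shortest (W̃ q r W) W̃-fixes)) (length-W̃-bound n q r W n≡))
  where
  W̃-fixes = W̃-fixes-balanced n q r n≡ r<3 W W-fixes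
  -- The word `W̃ q r W` itself bounds the search for a shortest one.
  B,shortest = shortest fixesAllBalanced? (W̃ q r W) W̃-fixes
  B = proj₁ B,shortest
  B-shortest = proj₂ B,shortest
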